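{- Let $n\in\mathbb{N}$, $n\ge 4$, and let $K_n$ be the complete graph on $n$ vertices. There exists no minimal SLSE temporal graph on $K_n$. In fact, for any SLSE labelling $L$ of $K_n$ one can remove at least $\lfloor n/4\rfloor$ labels from $L$ without violating TC.
   Context: A labelling of an undirected graph $G=(V,E)$ is an assignment $L=\{L_e\subseteq\mathbb{N}^*:e\in E\}$ of sets of positive integer labels to edges; $G(L)=(V,E,L)$ is the resulting temporal graph. An SLSE (single-label-single-edge) labelling is one in which each edge has exactly one label and no two edges have the same label; the resulting temporal graph is called an SLSE temporal graph. A $(u,v)$-journey is a sequence $(u,u_1,l_1),(u_1,u_2,l_2),\ldots,(u_{k-1},v,l_k)$ in which each consecutive pair of vertices forms an edge $e$ with the corresponding label in $L_e$, and $l_1<l_2<\cdots<l_k$. $G(L)$ satisfies TC if for every ordered pair of distinct vertices $u,v$ there is a $(u,v)$-journey. $G(L)$ is minimal if it satisfies TC and the removal of any single label from any $L_e$ results in a temporal graph that does not satisfy TC. -}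

module Defs where

open import Data.Fin using (Fin)
open import Data.List using (List; [_])
open import Data.List.Relation.Unary.All using (All)
open import Data.Nat using (ℕ; _<_)
open import Data.Product using (_×_; _,_; ∃; ∃!)
open import Data.Sum using (_⊎_; inj₁; inj₂)
open import Level using (0ℓ)
open import Relation.Binary.Bundles using (Setoid)
open import Relation.Binary.Core using (Rel)
open import Relation.Binary.Definitions using (Symmetric; Irreflexive)
open import Relation.Binary.PropositionalEquality using (_≡_; _≢_; refl; ≢-sym)
open import Relation.Nullary using (¬_; contradiction)

open import Data.List.Membership.Setoid.Properties using (∈-resp-≈)
import Data.List.Membership.Setoid as Membership

record Graph (n : ℕ) : Set₁ where
  field
    Adj        : Rel (Fin n) 0ℓ
    adj-sym    : Symmetric Adj
    adj-irrefl : Irreflexive _≡_ Adj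

K : ∀ n → Graph n
K n = record
  { Adj        = _≢_
  ; adj-sym    = ≢-sym
  ; adj-irrefl = λ eq neq → contradiction eq neq
  }

-- A labelled edge is written (u , v) , l. Since edges are undirected,
-- (u , v) , l and (v , u) , l are the same labelled edge.

SameEdge : ∀ {n} → Rel (Fin n × Fin n) 0ℓ
SameEdge (u , v) (u′ , v′) = (u ≡ u′ × v ≡ v′) ⊎ (u ≡ v′ × v ≡ u′)

LabelledEdge : ℕ → Setoid 0ℓ 0ℓ
LabelledEdge n = record
  { Carrier       = (Fin n × Fin n) × ℕ
  ; _≈_           = λ (e , l) (e′ , l′) → SameEdge e e′ × l ≡ l′
  ; isEquivalence = record
    { refl  = inj₁ (refl , refl) , refl
    ; sym   = λ { (inj₁ (refl , refl) , refl) → inj₁ (refl , refl) , refl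
                ; (inj₂ (refl , refl) , refl) → inj₂ (refl , refl) , refl }
    ; trans = λ { (inj₁ (refl , refl) , refl) q → q
                ; (inj₂ (refl , refl) , refl) (inj₁ (refl , refl) , refl) →
                    inj₂ (refl , refl) , refl
                ; (inj₂ (refl , refl) , refl) (inj₂ (refl , refl) , refl) →
                    inj₁ (refl , refl) , refl }
    }
  }

-- Label u v is the set L_e of the edge e = uv. It depends only on the unordered
-- pair, and is empty when uv is not an edge.

record Labelling {n} (G : Graph n) : Set₁ where
  open Graph G
  field
    Label     : Fin n → Fin n → ℕ → Set
    label-sym : ∀ {u v l} → Label u v l → Label v u l
    label-adj : ∀ {u v l} → Label u v l → Adj u v
    label-pos : ∀ {u v l} → Label u v l → 0 < l

module _ {n} {G : Graph n} where
  open Graph G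
  open Labelling

  record SLSE (L : Labelling G) : Set where
    field
      single-label : ∀ {u v} → Adj u v → ∃! _≡_ (Label L u v)
      single-edge  : ∀ {u v u′ v′ l} → Label L u v l → Label L u′ v′ l →
                     SameEdge (u , v) (u′ , v′)

  -- JourneyFrom L l u v: the (u , v)-journeys whose first label is l.

  data JourneyFrom (L : Labelling G) : ℕ → Fin n → Fin n → Set where
    last : ∀ {u v l} → Label L u v l → JourneyFrom L l u v
    step : ∀ {u w v l l′} → Label L u w l → l < l′ →
           JourneyFrom L l′ w v → JourneyFrom L l u v

  Journey : Labelling G → Fin n → Fin n → Set
  Journey L u v = ∃ λ l → JourneyFrom L l u v

  TC : Labelling G → Set
  TC L = ∀ u v → u ≢ v → Journey L u v

  open Setoid (LabelledEdge n) using () renaming (Carrier to LEdge)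
  open Membership (LabelledEdge n) using (_∉_)

  infix 4 _⊆ᴸ_
  _⊆ᴸ_ : List LEdge → Labelling G → Set
  R ⊆ᴸ L = All (λ ((u , v) , l) → Label L u v l) R

  infixl 6 _∖_
  _∖_ : Labelling G → List LEdge → Labelling G
  L ∖ R = record
    { Label     = λ u v l → Label L u v l × ((u , v) , l) ∉ R
    ; label-sym = λ (p , q) → label-sym L p , λ r → q (∈-resp-≈ (LabelledEdge n) swap r)
    ; label-adj = λ (p , _) → label-adj L p
    ; label-pos = λ (p , _) → label-pos L p
    }
    where
    swap : ∀ {u v l} → Setoid._≈_ (LabelledEdge n) ((v , u) , l) ((u , v) , l)
    swap = inj₂ (refl , refl) , refl

  Minimal : Labelling G → Set
  Minimal L = TC L × (∀ u v l → Label L u v l → ¬ TC (L ∖ [ (u , v) , l ]))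

{-# OPTIONS --safe #-}
-- Among four vertices let cd carry the largest label, and let a, b be the other
-- two. Comparing the labels along the 4-cycle a c b d shows that one of ab, ac,
-- ad, bc, bd can be bypassed in both directions: either ab by two 2-paths, or
-- another one by a 3-path on the cycle and by a 2-path ending with cd. Applied to
-- ⌊n/4⌋ disjoint quadruples, this yields ⌊n/4⌋ labels that can be removed
-- simultaneously, since each bypass stays inside its own quadruple.
module Submission where

open import Defs
open import Data.Fin using (Fin; zero; suc; _≟_; combine; inject≤; punchIn; punchOut)
open import Data.Fin.Properties
  using (punchInᵢ≢i; punchIn-injective; punchIn-punchOut; inject≤-injective; combine-injective)
open import Data.List using (List; []; _∷_; [_]; length; tabulate; allFin; cartesianProduct)
open import Data.List.Extrema.Nat using (argmax; f[xs]≤f[argmax])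
open import Data.List.Membership.Propositional.Properties using (∈-allFin; ∈-cartesianProduct⁺)
import Data.List.Membership.Setoid as Membership
open import Data.List.Properties using (length-tabulate)
import Data.List.Relation.Unary.All as All
import Data.List.Relation.Unary.All.Properties as All
import Data.List.Relation.Unary.Any as Any
open import Data.List.Relation.Unary.Any using (here; there)
import Data.List.Relation.Unary.Any.Properties as Any
open import Data.List.Relation.Unary.Unique.Setoid using (Unique)
import Data.List.Relation.Unary.Unique.Setoid.Properties as Unique
open import Data.Nat using (ℕ; _≤_; _<_)
import Data.Nat as ℕ
open import Data.Nat.DivMod using (_/_; m/n*n≤m; /-monoˡ-≤)
open import Data.Nat.Properties using (<-cmp; ≤∧≢⇒<; ≤-reflexive; ≤-trans)
open import Data.Product using (_×_; _,_; ∃; ∃₂; proj₁; proj₂)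
import Data.Product as Product
open import Data.Sum using (_⊎_; inj₁; inj₂)
import Data.Sum as Sum
open import Function using (_∘_; id)
open import Function.Definitions using (Injective)
open import Relation.Binary.Bundles using (Setoid)
open import Relation.Binary.Definitions using (Decidable; tri<; tri≈; tri>)
open import Relation.Binary.PropositionalEquality using (_≡_; _≢_; refl; sym; cong; trans; subst; ≢-sym)
open import Relation.Nullary using (¬_; yes; no; contradiction)
open import Relation.Nullary.Decidable using (_×-dec_; _⊎-dec_)

open Labelling
open SLSE

LEdge : ℕ → Set
LEdge n = (Fin n × Fin n) × ℕ

module _ {n : ℕ} where
  open Setoid (LabelledEdge n) public using (_≈_)
  open Membership (LabelledEdge n) public using (_∉_)

  infix 4 _≈?_
  _≈?_ : Decidable _≈_
  ((u , v) , l) ≈? ((u′ , v′) , l′) =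
    ((u ≟ u′ ×-dec v ≟ v′) ⊎-dec (u ≟ v′ ×-dec v ≟ u′)) ×-dec l ℕ.≟ l′

-- Restriction to a subset of the vertices.

map-journeyFrom : ∀ {m n} {L : Labelling (K m)} {L′ : Labelling (K n)} (f : Fin m → Fin n) →
  (∀ {u v l} → Label L u v l → Label L′ (f u) (f v) l) →
  ∀ {u v l} → JourneyFrom L l u v → JourneyFrom L′ l (f u) (f v)
map-journeyFrom f h (last p)       = last (h p)
map-journeyFrom f h (step p l<l′ j) = step (h p) l<l′ (map-journeyFrom f h j)

induced : ∀ {m n} → (Fin m → Fin n) → Labelling (K n) → Labelling (K m)
induced f L = record
  { Label     = λ u v → Label L (f u) (f v)
  ; label-sym = label-sym L
  ; label-adj = λ p → label-adj L p ∘ cong f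
  ; label-pos = label-pos L
  }

induced-SLSE : ∀ {m n} {L : Labelling (K n)} {f : Fin m → Fin n} →
  Injective _≡_ _≡_ f → SLSE L → SLSE (induced f L)
induced-SLSE inj S = record
  { single-label = λ u≢v → single-label S (u≢v ∘ inj)
  ; single-edge  = λ p q → Sum.map (Product.map inj inj) (Product.map inj inj) (single-edge S p q)
  }

-- Both directions are demanded because a journey of several steps, reversed, has decreasing labels.
Bypassed : ∀ {n} → Labelling (K n) → LEdge n → Set
Bypassed L e@((u , v) , l) = Label L u v l × Journey (L ∖ [ e ]) u v × Journey (L ∖ [ e ]) v u

-- Bypasses around a single edge.

module _ {n} {L : Labelling (K n)} where

  -- The endpoint `z` lies off the removed edge `xy`, so the label survives wherever `u` lies.
  outside : ∀ {x y m u z l} → z ≢ x → z ≢ y →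
    Label L u z l → Label (L ∖ [ (x , y) , m ]) u z l
  outside z≢x z≢y p = p , λ
    { (here (inj₁ (_ , z≡y) , _)) → z≢y z≡y
    ; (here (inj₂ (_ , z≡x) , _)) → z≢x z≡x
    ; (there ()) }

  via : ∀ {x y m u z v l l′} → z ≢ x → z ≢ y →
    Label L u z l → Label L z v l′ → l < l′ → Journey (L ∖ [ (x , y) , m ]) u v
  via {x} {y} {m} z≢x z≢y p q l<l′ =
    _ , step (outside z≢x z≢y p) l<l′
          (last (label-sym (L ∖ [ (x , y) , m ]) (outside z≢x z≢y (label-sym L q))))

  via₂ : ∀ {x y m u z w v l l′ l″} → z ≢ x → z ≢ y → w ≢ x → w ≢ y →
    Label L u z l → Label L z w l′ → Label L w v l″ → l < l′ → l′ < l″ →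
    Journey (L ∖ [ (x , y) , m ]) u v
  via₂ z≢x z≢y w≢x w≢y p q r l<l′ l′<l″ =
    _ , step (outside z≢x z≢y p) l<l′ (proj₂ (via w≢x w≢y q r l′<l″))

  module _ (S : SLSE L) where

    -- Equal labels would make `uz` and `zv` the same edge, forcing `u ≡ z` or `u ≡ v`.
    consecutive-≢ : ∀ {u z v l l′} → u ≢ v → Label L u z l → Label L z v l′ → l ≢ l′
    consecutive-≢ u≢v p q refl with single-edge S p q
    ... | inj₁ (u≡z , _) = label-adj L p u≡z
    ... | inj₂ (u≡v , _) = u≢v u≡v

    consecutive-ordered : ∀ {u z v l l′} → u ≢ v → Label L u z l → Label L z v l′ → l < l′ ⊎ l′ < l
    consecutive-ordered {l = l} {l′} u≢v p q with <-cmp l l′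
    ... | tri< l<l′ _ _ = inj₁ l<l′
    ... | tri≈ _ l≡l′ _ = contradiction l≡l′ (consecutive-≢ u≢v p q)
    ... | tri> _ _ l′<l = inj₂ l′<l

    max-edge⇒bypassed : ∀ {a b c d ω} → a ≢ b → a ≢ c → a ≢ d → b ≢ c → b ≢ d →
      Label L c d ω → (∀ {u v l} → Label L u v l → l ≤ ω) → ∃ (Bypassed L)
    max-edge⇒bypassed {a} {b} {c} {d} {ω} a≢b a≢c a≢d b≢c b≢d cd maximal =
      -- One comparison at each vertex of the 4-cycle, in the order `c`, `d`, `a`, `b`.
      go (consecutive-ordered a≢b ac cb) (consecutive-ordered a≢b ad db)
         (consecutive-ordered c≢d ca ad) (consecutive-ordered c≢d cb bd)
      where
      c≢d = label-adj L cd
      ab  = proj₁ (proj₂ (single-label S a≢b))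
      ac  = proj₁ (proj₂ (single-label S a≢c))
      bc  = proj₁ (proj₂ (single-label S b≢c))
      ad  = proj₁ (proj₂ (single-label S a≢d))
      bd  = proj₁ (proj₂ (single-label S b≢d))
      ba  = label-sym L ab
      ca  = label-sym L ac
      cb  = label-sym L bc
      da  = label-sym L ad
      db  = label-sym L bd
      dc  = label-sym L cd

      -- Maximality gives only a weak inequality; meeting `cd` at `c` makes it strict.
      below-cd : ∀ {u l} → u ≢ d → Label L u c l → l < ω
      below-cd u≢d uc = ≤∧≢⇒< (maximal uc) (consecutive-≢ u≢d uc cd)

      below-dc : ∀ {u l} → u ≢ c → Label L u d l → l < ω
      below-dc u≢c ud = ≤∧≢⇒< (maximal ud) (consecutive-≢ u≢c ud dc)

      λac = proj₁ (single-label S a≢c)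
      λbc = proj₁ (single-label S b≢c)
      λad = proj₁ (single-label S a≢d)
      λbd = proj₁ (single-label S b≢d)

      go : λac < λbc ⊎ λbc < λac → λad < λbd ⊎ λbd < λad →
           λac < λad ⊎ λad < λac → λbc < λbd ⊎ λbd < λbc → ∃ (Bypassed L)
      -- The orders at `c` and `d` point opposite ways, so each 2-path serves one direction of `ab`.
      go (inj₁ ac<bc) (inj₂ bd<ad) _ _ =
        _ , ab , via (≢-sym a≢c) (≢-sym b≢c) ac cb ac<bc , via (≢-sym a≢d) (≢-sym b≢d) bd da bd<ad
      go (inj₂ bc<ac) (inj₁ ad<bd) _ _ =
        _ , ab , via (≢-sym a≢d) (≢-sym b≢d) ad db ad<bd , via (≢-sym a≢c) (≢-sym b≢c) bc ca bc<ac
      -- Both orders point from `a` to `b`. Starting with the smaller of `ac` and `ad`, three edges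
      -- of the cycle increase up to `b`; the fourth edge is the one bypassed.
      go (inj₁ ac<bc) (inj₁ ad<bd) (inj₁ ac<ad) _ =
        _ , bc , via (≢-sym b≢d) (≢-sym c≢d) bd dc (below-dc b≢c bd)
               , via₂ a≢b a≢c (≢-sym b≢d) (≢-sym c≢d) ca ad db ac<ad ad<bd
      go (inj₁ ac<bc) (inj₁ ad<bd) (inj₂ ad<ac) _ =
        _ , bd , via (≢-sym b≢c) c≢d bc cd (below-cd b≢d bc)
               , via₂ a≢b a≢d (≢-sym b≢c) c≢d da ac cb ad<ac ac<bc
      -- The previous two cases with `a` and `b` exchanged.
      go (inj₂ bc<ac) (inj₂ bd<ad) _ (inj₁ bc<bd) =
        _ , ac , via (≢-sym a≢d) (≢-sym c≢d) ad dc (below-dc a≢c ad)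
               , via₂ (≢-sym a≢b) b≢c (≢-sym a≢d) (≢-sym c≢d) cb bd da bc<bd bd<ad
      go (inj₂ bc<ac) (inj₂ bd<ad) _ (inj₂ bd<bc) =
        _ , ad , via (≢-sym a≢c) c≢d ac cd (below-cd a≢d ac)
               , via₂ (≢-sym a≢b) b≢d (≢-sym a≢c) c≢d db bc ca bd<bc bc<ac

max-label : ∀ {n} {L : Labelling (K (2 ℕ.+ n))} → SLSE L →
  ∃₂ λ c d → ∃ λ ω → Label L c d ω × (∀ {u v l} → Label L u v l → l ≤ ω)
max-label {n} {L} S =
  _ , _ , _ , proj₁ (proj₂ (single-label S (distinct i*))) , maximal
  where
  -- The pair (u , j) stands for the edge from u to punchIn u j.
  distinct : ((u , j) : Fin (2 ℕ.+ n) × Fin (1 ℕ.+ n)) → u ≢ punchIn u j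
  distinct (u , j) = ≢-sym (punchInᵢ≢i u j)

  label : Fin (2 ℕ.+ n) × Fin (1 ℕ.+ n) → ℕ
  label i = proj₁ (single-label S (distinct i))

  edges = cartesianProduct (allFin (2 ℕ.+ n)) (allFin (1 ℕ.+ n))

  -- Every index pair names an edge, the default `(zero , zero)` included.
  i* = argmax label (zero , zero) edges

  maximal : ∀ {u v l} → Label L u v l → l ≤ label i*
  maximal {u} {v} {l} uv = subst (_≤ label i*) label≡l
    (All.lookup (f[xs]≤f[argmax] {f = label} (zero , zero) edges)
      (∈-cartesianProduct⁺ (∈-allFin u) (∈-allFin j)))
    where
    u≢v = label-adj L uv
    j   = punchOut u≢v

    label≡l : label (u , j) ≡ l
    -- Uniqueness in `single-label` identifies an arbitrary label of `uv` with the one entering the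
    -- maximum.
    label≡l = proj₂ (proj₂ (single-label S (distinct (u , j))))
      (subst (λ w → Label L u w l) (sym (punchIn-punchOut u≢v)) uv)

-- Skipping `c`, and then the position `j` that `d` takes once `c` is skipped, leaves `2 + n`
-- vertices, of which the first two serve.
two-others : ∀ {n} {c d : Fin (4 ℕ.+ n)} → c ≢ d →
  ∃₂ λ a b → a ≢ b × a ≢ c × a ≢ d × b ≢ c × b ≢ d
two-others {n} {c} {d} c≢d =
  other zero , other (suc zero) , other-injective , punchInᵢ≢i c _ , other≢d zero ,
  punchInᵢ≢i c _ , other≢d (suc zero)
  where
  j = punchOut c≢d

  other : Fin (2 ℕ.+ n) → Fin (4 ℕ.+ n)
  other = punchIn c ∘ punchIn j

  other-injective : other zero ≢ other (suc zero)
  other-injective eq with () ← punchIn-injective j _ _ (punchIn-injective c _ _ eq)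

  other≢d : ∀ k → other k ≢ d
  other≢d k eq = punchInᵢ≢i j k
    (punchIn-injective c _ _ (trans eq (sym (punchIn-punchOut c≢d))))

-- Unfolding the choice of the bypassed edge makes type checking infeasible.
abstract
  K₄-bypassed : {L : Labelling (K 4)} → SLSE L → ∃ (Bypassed L)
  K₄-bypassed {L} S =
    let c , d , _ , cd , maximal = max-label S
        a , b , a≢b , a≢c , a≢d , b≢c , b≢d = two-others (label-adj L cd)
    in max-edge⇒bypassed S a≢b a≢c a≢d b≢c b≢d cd maximal

-- Simultaneous removal from disjoint quadruples.

module Quadruples {n} (L : Labelling (K n)) (S : SLSE L) where

  -- Quadruple `k` consists of the vertices `4k` to `4k + 3`; at most three vertices lie in no
  -- quadruple.
  quad : Fin (n / 4) → Fin 4 → Fin n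
  quad k i = inject≤ (combine k i) (m/n*n≤m n 4)

  quad-injective : ∀ {k k′ i i′} → quad k i ≡ quad k′ i′ → k ≡ k′ × i ≡ i′
  quad-injective {k} {k′} {i} {i′} eq =
    combine-injective k i k′ i′ (inject≤-injective _ _ _ _ eq)

  bypassed : ∀ k → ∃ (Bypassed (induced (quad k) L))
  bypassed k = K₄-bypassed (induced-SLSE (proj₂ ∘ quad-injective) S)

  embed : Fin (n / 4) → LEdge 4 → LEdge n
  embed k ((i , j) , l) = (quad k i , quad k j) , l

  -- Disjointness of the quadruples lets a single endpoint determine `k`.
  embed-injective : ∀ {k k′ e e′} → embed k e ≈ embed k′ e′ → k ≡ k′ × e ≈ e′
  embed-injective (inj₁ (p , q) , l≡l′) =
    proj₁ (quad-injective p) , inj₁ (proj₂ (quad-injective p) , proj₂ (quad-injective q)) , l≡l′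
  embed-injective (inj₂ (p , q) , l≡l′) =
    proj₁ (quad-injective p) , inj₂ (proj₂ (quad-injective p) , proj₂ (quad-injective q)) , l≡l′

  removed : Fin (n / 4) → LEdge n
  removed k = embed k (proj₁ (bypassed k))

  R : List (LEdge n)
  R = tabulate removed

  R-unique : Unique (LabelledEdge n) R
  R-unique = Unique.tabulate⁺ (LabelledEdge n) (proj₁ ∘ embed-injective)

  R⊆L : R ⊆ᴸ L
  R⊆L = All.tabulate⁺ λ k → proj₁ (proj₂ (bypassed k))

  -- Labels removed for other quadruples lie on edges disjoint from quadruple `k`, so only its own
  -- removal can affect it.
  ∉-embed : ∀ k {e} → e ∉ [ proj₁ (bypassed k) ] → embed k e ∉ R
  ∉-embed k e∉ e∈R with Any.tabulate⁻ e∈R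
  ... | k′ , e≈ with embed-injective e≈
  ...   | refl , e≈′ = e∉ (here e≈′)

  embed-journey : ∀ k {i j} → Journey (induced (quad k) L ∖ [ proj₁ (bypassed k) ]) i j →
    Journey (L ∖ R) (quad k i) (quad k j)
  embed-journey k (_ , j) = _ , map-journeyFrom (quad k) (λ (p , e∉) → p , ∉-embed k e∉) j

  L∖R-TC : TC (L ∖ R)
  L∖R-TC u v u≢v with single-label S u≢v
  ... | l , uv , _ with Any.any? (((u , v) , l) ≈?_) R
  ...   | no  e∉R = _ , last (uv , e∉R)
  ...   | yes e∈R with Any.tabulate⁻ e∈R
  -- The orientation in which the removed edge was stored decides which of its two bypasses applies.
  ...     | k , inj₁ (refl , refl) , _ = embed-journey k (proj₁ (proj₂ (proj₂ (bypassed k))))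
  ...     | k , inj₂ (refl , refl) , _ = embed-journey k (proj₂ (proj₂ (proj₂ (bypassed k))))

-- Restoring labels keeps all journeys, so if `R` contained some `e`, removing `e` alone would also
-- preserve TC, against minimality.
minimal⇒irreducible : ∀ {n} {L : Labelling (K n)} → Minimal L →
  ∀ R → R ⊆ᴸ L → TC (L ∖ R) → length R ≡ 0
minimal⇒irreducible _       []      _            _  = refl
minimal⇒irreducible (_ , m) (e ∷ R) (p All.∷ _) tc = contradiction
  (λ u v u≢v → Product.map₂ (map-journeyFrom id (Product.map₂ λ e∉ → λ { (here q) → e∉ (here q) }))
                            (tc u v u≢v))
  (m _ _ _ p)

theorem4 : (n : ℕ) → 4 ≤ n →
    (¬ ∃ λ (L : Labelling (K n)) → SLSE L × Minimal L) ×
    (∀ (L : Labelling (K n)) → SLSE L →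
    ∃ λ R → Unique (LabelledEdge n) R × R ⊆ᴸ L × n / 4 ≤ length R × TC (L ∖ R))
theorem4 n 4≤n = no-minimal , removable
  where
  removable : ∀ (L : Labelling (K n)) → SLSE L →
    ∃ λ R → Unique (LabelledEdge n) R × R ⊆ᴸ L × n / 4 ≤ length R × TC (L ∖ R)
  removable L S = R , R-unique , R⊆L , ≤-reflexive (sym (length-tabulate removed)) , L∖R-TC
    where open Quadruples L S

  no-minimal : ¬ ∃ λ (L : Labelling (K n)) → SLSE L × Minimal L
  no-minimal (L , S , minimal) with removable L S
  ... | R , _ , R⊆L , n/4≤∣R∣ , tc
    -- From `4 ≤ n` follows `1 ≤ n / 4`, so `R` cannot be empty.
    with () ← subst (1 ≤_) (minimal⇒irreducible minimal R R⊆L tc)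
                (≤-trans (/-monoˡ-≤ 4 4≤n) n/4≤∣R∣)
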